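{- For every integer $k\ge 4$, $\tilde{r}(P_3,P_3,C_{4k+3}) \le 6k+5$.
   Context: $P_m$ denotes the path and $C_m$ the cycle on $m$ vertices. The three-color online Ramsey game for graphs $G_1,G_2,G_3$ is played by Builder and Painter on an infinite vertex set with initially no edges. In each round Builder draws an edge between two currently nonadjacent vertices, and Painter immediately colors it red, blue or green. Builder wins once the colored graph contains a red copy of $G_1$, a blue copy of $G_2$, or a green copy of $G_3$. The online Ramsey number $\tilde{r}(G_1,G_2,G_3)$ is the minimum number of rounds within which Builder can guarantee a win against every strategy of Painter. -}

module Defs where

open import Data.Nat using (ℕ; zero; suc; _+_; _*_; _∸_; _≤_)
open import Data.Fin using (Fin; toℕ)
open import Data.List using (List; []; _∷_)
open import Data.List.Membership.Propositional using (_∈_)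
open import Data.Product using (Σ; _×_; _,_; ∃)
open import Data.Sum using (_⊎_)
open import Relation.Binary.PropositionalEquality using (_≡_)
open import Relation.Nullary using (¬_)
open import Function.Definitions using (Injective)

data Colour : Set where
  red blue green : Colour

-- A coloured edge: two endpoints (vertices are natural numbers, the
-- infinite vertex set) and a colour. Edges are undirected; the pair
-- (u , v) is read as the edge {u, v}.
ColouredEdge : Set
ColouredEdge = ℕ × ℕ × Colour

Board : Set
Board = List ColouredEdge

HasEdge : Board → Colour → ℕ → ℕ → Set
HasEdge B c u v = ((u , v , c) ∈ B) ⊎ ((v , u , c) ∈ B)

Adjacent : Board → ℕ → ℕ → Set
Adjacent B u v = ∃ λ c → HasEdge B c u v

Graph : ℕ → Set₁
Graph m = Fin m → Fin m → Set

Path : (m : ℕ) → Graph m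
Path m i j = (toℕ j ≡ suc (toℕ i)) ⊎ (toℕ i ≡ suc (toℕ j))

-- The cycle C_m (m ≥ 3): the path P_m plus the edge {0, m-1}.
Cycle : (m : ℕ) → Graph m
Cycle m i j = Path m i j
  ⊎ ((toℕ i ≡ 0 × toℕ j ≡ m ∸ 1) ⊎ (toℕ j ≡ 0 × toℕ i ≡ m ∸ 1))

HasMonoCopy : Board → Colour → {m : ℕ} → Graph m → Set
HasMonoCopy B c {m} G =
  Σ (Fin m → ℕ) λ f → Injective _≡_ _≡_ f × (∀ i j → G i j → HasEdge B c (f i) (f j))

Won : ∀ {m₁ m₂ m₃} → Graph m₁ → Graph m₂ → Graph m₃ → Board → Set
Won G₁ G₂ G₃ B = HasMonoCopy B red G₁ ⊎ HasMonoCopy B blue G₂ ⊎ HasMonoCopy B green G₃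

-- BuilderWinsWithin G₁ G₂ G₃ n B : from position B, Builder can guarantee a
-- win within at most n further rounds, whatever Painter does. In a round
-- Builder draws an edge between two distinct, currently nonadjacent vertices
-- and Painter colours it with any of the three colours.
data BuilderWinsWithin {m₁ m₂ m₃ : ℕ} (G₁ : Graph m₁) (G₂ : Graph m₂) (G₃ : Graph m₃)
     : ℕ → Board → Set where
  won  : ∀ {n B} → Won G₁ G₂ G₃ B → BuilderWinsWithin G₁ G₂ G₃ n B
  move : ∀ {n B} (u v : ℕ) → ¬ (u ≡ v) → ¬ Adjacent B u v →
         (∀ c → BuilderWinsWithin G₁ G₂ G₃ n ((u , v , c) ∷ B)) →
         BuilderWinsWithin G₁ G₂ G₃ (suc n) B

OnlineRamseyAtMost : ∀ {m₁ m₂ m₃} → Graph m₁ → Graph m₂ → Graph m₃ → ℕ → Set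
OnlineRamseyAtMost G₁ G₂ G₃ N = BuilderWinsWithin G₁ G₂ G₃ N []

{-# OPTIONS --safe #-}
module Submission where

-- Red and blue edges must form matchings, so an edge is forced to be green as
-- soon as its two ends together meet both red and blue.  Builder keeps one long
-- green path (in the tight line of play, two) and remembers only which of red
-- and blue occur at its ends.  A vertex meeting both colours forces two green
-- edges, and a vertex meeting red forces the edge to a vertex meeting blue;
-- hence a game on a few new vertices can lengthen the path by four at the cost
-- of two non-green edges, and Painter's unforced green answers only leave
-- Builder a surplus.  Iterated, this gains four vertices in six rounds; when few
-- vertices are missing, the surplus pays for a cycle of the exact length.

open import Defs
open import Data.Bool using (Bool; true; false; T; _xor_)
open import Data.Bool.Properties as Boolₚ using (T?)
open import Data.Empty using (⊥; ⊥-elim)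
open import Data.Fin using (Fin; zero; suc; toℕ)
open import Data.Fin.Properties using (all?; toℕ<n; toℕ-injective) renaming (_≟_ to _≟ᶠ_)
open import Data.Fin.Patterns using (0F; 1F; 2F; 3F; 4F; 5F)
open import Data.List using (List; []; _∷_; _++_; map; concatMap; length; lookup; reverse; allFin)
open import Data.List.Membership.Propositional using (_∈_; find)
open import Data.List.Membership.Propositional.Properties using (∈-++⁺ˡ; ∈-++⁺ʳ; ∈-++⁻; ∈-map⁺; ∈-map⁻; ∈-lookup)
open import Data.List.Properties using (length-++; length-reverse; map-++; unfold-reverse)
import Data.List.Properties as Listₚ
open import Data.List.NonEmpty using (List⁺; _∷_; toList; _⁺++⁺_)
open import Data.List.Relation.Unary.All as All using (All; []; _∷_)
import Data.List.Relation.Unary.All.Properties as Allₚ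
open import Data.List.Relation.Unary.AllPairs as AllPairs using (AllPairs; []; _∷_; allPairs?)
import Data.List.Relation.Unary.AllPairs.Properties as AllPairsₚ
open import Data.List.Relation.Unary.Any as Any using (Any; here; there)
import Data.List.Relation.Unary.Any.Properties as Anyₚ
open import Data.List.Relation.Unary.Unique.Propositional using (Unique)
import Data.List.Relation.Unary.Unique.Propositional.Properties as Uniqueₚ
open import Data.List.Relation.Binary.Disjoint.Propositional using (Disjoint)
open import Data.Nat using (ℕ; zero; suc; _+_; _*_; _∸_; _≤_; _<_; s≤s)
open import Data.Nat.ListAction using (sum)
open import Data.Nat.ListAction.Properties using (sum-++)
open import Data.Nat.Properties using (<-irrefl; <-≤-trans; m≤m+n; m≤n+m; n≤1+n; +-monoʳ-<; +-cancelˡ-≡; +-assoc; +-identityʳ; +-suc; +-monoˡ-≤; suc-injective) renaming (_≟_ to _≟ⁿ_; _≤?_ to _≤ⁿ?_)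
open import Data.Nat.Tactic.RingSolver using (solve-∀)
open import Data.Product using (∃; _×_; _,_; proj₁; proj₂)
open import Data.Product.Properties using (≡-dec)
open import Data.Sum as Sum using (_⊎_; inj₁; inj₂)
open import Data.Unit using (⊤; tt)
open import Data.Vec as Vec using (Vec; []; _∷_)
open import Function using (_∘_; id)
open import Relation.Binary.PropositionalEquality using (_≡_; _≢_; refl; sym; trans; cong; subst)
open import Relation.Nullary using (¬_; Dec; yes; no; contradiction)
open import Relation.Nullary.Decidable using (_×-dec_; _⊎-dec_; ¬?; map′; does; True; toWitness)

-- Coloured boards

edge-sym : ∀ {B c u v} → HasEdge B c u v → HasEdge B c v u
edge-sym = Sum.swap

edge-mono : ∀ {B B′ c u v} → (∀ {e} → e ∈ B → e ∈ B′) → HasEdge B c u v → HasEdge B′ c u v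
edge-mono sub = Sum.map sub sub

-- A board is any list of triples and may contain loops. A loop cannot be extended to a `Path 3`,
-- hence the inequality.
Touches : Board → Colour → ℕ → Set
Touches B c u = ∃ λ v → u ≢ v × HasEdge B c u v

touches-mono : ∀ {B B′ c v} → (∀ {e} → e ∈ B → e ∈ B′) → Touches B c v → Touches B′ c v
touches-mono {B} sub (w , v≢w , e) = w , v≢w , edge-mono {B} sub e

path₃ : ∀ {B c x y z} → x ≢ y → y ≢ z → x ≢ z →
        HasEdge B c x y → HasEdge B c y z → HasMonoCopy B c (Path 3)
path₃ {B} {c} {x} {y} {z} x≢y y≢z x≢z xy yz = f , inj , edges
  where
  f : Fin 3 → ℕ
  f 0F = x
  f 1F = y
  f 2F = z
  inj : ∀ {i j} → f i ≡ f j → i ≡ j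
  inj {0F} {0F} _ = refl
  inj {0F} {1F} p = contradiction p x≢y
  inj {0F} {2F} p = contradiction p x≢z
  inj {1F} {0F} p = contradiction (sym p) x≢y
  inj {1F} {1F} _ = refl
  inj {1F} {2F} p = contradiction p y≢z
  inj {2F} {0F} p = contradiction (sym p) x≢z
  inj {2F} {1F} p = contradiction (sym p) y≢z
  inj {2F} {2F} _ = refl
  edges : ∀ i j → Path 3 i j → HasEdge B c (f i) (f j)
  edges 0F 1F _ = xy
  edges 1F 2F _ = yz
  edges 1F 0F _ = edge-sym {B} xy
  edges 2F 1F _ = edge-sym {B} yz
  edges 0F 0F (inj₁ ())
  edges 0F 0F (inj₂ ())
  edges 0F 2F (inj₁ ())
  edges 0F 2F (inj₂ ())
  edges 1F 1F (inj₁ ())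
  edges 1F 1F (inj₂ ())
  edges 2F 0F (inj₁ ())
  edges 2F 0F (inj₂ ())
  edges 2F 2F (inj₁ ())
  edges 2F 2F (inj₂ ())

-- Builder's only threat in red and blue, and the source of every forced green edge. Nonadjacency
-- keeps the older edge from running between `u` and `v`, so its far end is a third vertex.
path₃-new : ∀ {B c u v} → u ≢ v → ¬ Adjacent B u v → Touches B c u ⊎ Touches B c v →
            HasMonoCopy ((u , v , c) ∷ B) c (Path 3)
path₃-new {B} {c} {u} {v} u≢v free (inj₁ (w , u≢w , uw)) =
  path₃ (u≢v ∘ sym) u≢w (λ { refl → free (c , uw) })
    (inj₂ (here refl)) (edge-mono {B} there uw)
path₃-new {B} {c} {u} {v} u≢v free (inj₂ (w , v≢w , vw)) =
  path₃ u≢v v≢w (λ { refl → free (c , edge-sym {B} vw) })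
    (inj₁ (here refl)) (edge-mono {B} there vw)

-- Green walks and the cycles they close

data Walk (B : Board) : ℕ → List ℕ → ℕ → Set where
  stay : ∀ {u} → Walk B u (u ∷ []) u
  step : ∀ {u v w xs} → HasEdge B green u v → Walk B v xs w → Walk B u (u ∷ xs) w

walk-mono : ∀ {B B′ u xs v} → (∀ {e} → e ∈ B → e ∈ B′) → Walk B u xs v → Walk B′ u xs v
walk-mono sub stay = stay
walk-mono {B} sub (step e w) = step (edge-mono {B} sub e) (walk-mono sub w)

walk-++ : ∀ {B u xs v w ys x} → Walk B u xs v → HasEdge B green v w → Walk B w ys x →
          Walk B u (xs ++ ys) x
walk-++ stay e w′ = step e w′
walk-++ (step e₀ w) e w′ = step e₀ (walk-++ w e w′)

walk-reverse : ∀ {B u xs v} → Walk B u xs v → Walk B v (reverse xs) u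
walk-reverse stay = stay
walk-reverse {B} {u} (step {xs = xs} e w) =
  subst (λ ys → Walk B _ ys u) (sym (unfold-reverse u xs)) (walk-++ (walk-reverse w) (edge-sym {B} e) stay)

first∈ : ∀ {B u xs v} → Walk B u xs v → u ∈ xs
first∈ stay = here refl
first∈ (step _ _) = here refl

last∈ : ∀ {B u xs v} → Walk B u xs v → v ∈ xs
last∈ stay = here refl
last∈ (step _ w) = there (last∈ w)

unique-reverse : ∀ {xs : List ℕ} → Unique xs → Unique (reverse xs)
unique-reverse {[]} [] = []
unique-reverse {x ∷ xs} (x∉ ∷ u) = subst Unique (sym (unfold-reverse x xs))
  (Uniqueₚ.++⁺ (unique-reverse u) ([] ∷ [])
    λ { (v∈ , here refl) → All.lookup x∉ (Anyₚ.reverse⁻ v∈) refl })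

lookup-injective : ∀ {xs : List ℕ} → Unique xs → ∀ i j → lookup xs i ≡ lookup xs j → i ≡ j
lookup-injective (_ ∷ _) zero zero _ = refl
lookup-injective (x∉ ∷ _) zero (suc j) p = contradiction p (All.lookup x∉ (∈-lookup j))
lookup-injective (x∉ ∷ _) (suc i) zero p = contradiction (sym p) (All.lookup x∉ (∈-lookup i))
lookup-injective (_ ∷ u) (suc i) (suc j) p = cong suc (lookup-injective u i j p)

lookup-first : ∀ {B u xs v} → Walk B u xs v → ∀ i → toℕ i ≡ 0 → lookup xs i ≡ u
lookup-first stay zero _ = refl
lookup-first (step _ _) zero _ = refl

lookup-last : ∀ {B u xs v} → Walk B u xs v → ∀ i → toℕ i ≡ length xs ∸ 1 → lookup xs i ≡ v
lookup-last stay zero _ = refl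
lookup-last (step _ w@stay) (suc i) p = lookup-last w i (suc-injective p)
lookup-last (step _ w@(step _ _)) (suc i) p = lookup-last w i (suc-injective p)

lookup-next : ∀ {B u xs v} → Walk B u xs v → ∀ i j → toℕ j ≡ suc (toℕ i) →
              HasEdge B green (lookup xs i) (lookup xs j)
lookup-next {B} (step e w) zero (suc j) p =
  subst (HasEdge B green _) (sym (lookup-first w j (suc-injective p))) e
lookup-next (step _ w) (suc i) (suc j) p = lookup-next w i j (suc-injective p)
lookup-next stay zero zero ()

walk-cycle : ∀ {B u xs v} → Walk B u xs v → Unique xs → HasEdge B green v u →
             HasMonoCopy B green (Cycle (length xs))
walk-cycle {B} {u} {xs} {v} w uniq vu = lookup xs , (λ {i} {j} → lookup-injective uniq i j) , edges
  where
  ends : ∀ i j → toℕ i ≡ 0 → toℕ j ≡ length xs ∸ 1 → HasEdge B green (lookup xs i) (lookup xs j)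
  ends i j p q rewrite lookup-first w i p | lookup-last w j q = edge-sym {B} vu
  edges : ∀ i j → Cycle (length xs) i j → HasEdge B green (lookup xs i) (lookup xs j)
  edges i j (inj₁ (inj₁ p)) = lookup-next w i j p
  edges i j (inj₁ (inj₂ p)) = edge-sym {B} (lookup-next w j i p)
  edges i j (inj₂ (inj₁ (p , q))) = ends i j p q
  edges i j (inj₂ (inj₂ (p , q))) = edge-sym {B} (ends j i p q)

wins-mono : ∀ {m₁ m₂ m₃} {G₁ : Graph m₁} {G₂ : Graph m₂} {G₃ : Graph m₃} {n n′ B} → n ≤ n′ →
            BuilderWinsWithin G₁ G₂ G₃ n B → BuilderWinsWithin G₁ G₂ G₃ n′ B
wins-mono _ (won w) = won w
wins-mono (s≤s p) (move u v u≢v free next) = move u v u≢v free (λ c → wins-mono p (next c))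

-- Strategy trees near the ends of long green paths

-- `src i` and `tgt i` are the ends of the i-th long green path, which as a
-- whole is `fwd i` or, reversed, `bwd i`; `new n` has not been used before.
data Vertex (k : ℕ) : Set where
  src tgt : Fin k → Vertex k
  new     : Fin 8 → Vertex k

data Item (k : ℕ) : Set where
  fwd bwd : Fin k → Item k
  new     : Fin 8 → Item k

-- `left` and `right` list non-green colours present at the two ends; `long`
-- says that the ends are different vertices.
record SegmentKind : Set where
  constructor segment
  field
    left right : List Colour
    long       : Bool

open SegmentKind

Kind : ℕ → Set
Kind = Vec SegmentKind

Edges : ℕ → Set
Edges k = List (Vertex k × Vertex k × Colour)

entry exit : ∀ {k} → Item k → Vertex k
entry (fwd i) = src i
entry (bwd i) = tgt i
entry (new n) = new n
exit (fwd i) = tgt i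
exit (bwd i) = src i
exit (new n) = new n

segments : ∀ {k} → List (Item k) → List (Fin k)
segments [] = []
segments (fwd i ∷ xs) = i ∷ segments xs
segments (bwd i ∷ xs) = i ∷ segments xs
segments (new _ ∷ xs) = segments xs

added : ∀ {k} → List (Item k) → ℕ
added [] = 0
added (fwd _ ∷ xs) = added xs
added (bwd _ ∷ xs) = added xs
added (new _ ∷ xs) = suc (added xs)

data Target : Set where
  finish : Target
  reach  : ∀ {k} → Kind k → Target

arity : Target → ℕ
arity finish = 1
arity (reach {k} _) = k

Path⁺ : ℕ → Set
Path⁺ k = List⁺ (Item k)

-- A leaf arranges long paths and new vertices into green paths of the kind
-- given by its target, up to exchanging red and blue if `swap` holds; `void`
-- stands for answers that lose at once.
data Tree (k : ℕ) {g : ℕ} (ts : Vec Target g) : Set where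
  offer : (u v : Vertex k) (ifGreen ifRed ifBlue : Tree k ts) → Tree k ts
  leaf  : (i : Fin g) (swap : Bool) → Vec (Path⁺ k) (arity (Vec.lookup ts i)) → Tree k ts
  void  : Tree k ts

-- Exchanging red and blue

paint : Bool → Colour → Colour
paint false c     = c
paint true  red   = blue
paint true  blue  = red
paint true  green = green

paint-involutive : ∀ s c → paint s (paint s c) ≡ c
paint-involutive false c     = refl
paint-involutive true  red   = refl
paint-involutive true  blue  = refl
paint-involutive true  green = refl

paint-green : ∀ s → paint s green ≡ green
paint-green false = refl
paint-green true  = refl

paint-xor : ∀ s s′ c → paint (s xor s′) c ≡ paint s (paint s′ c)
paint-xor false s′    c = refl
paint-xor true  false c = refl
paint-xor true  true  c = sym (paint-involutive true c)

infix 4 _≟ᶜ_ _≟ᵛ_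

_≟ᶜ_ : (c d : Colour) → Dec (c ≡ d)
red   ≟ᶜ red   = yes refl
red   ≟ᶜ blue  = no λ ()
red   ≟ᶜ green = no λ ()
blue  ≟ᶜ red   = no λ ()
blue  ≟ᶜ blue  = yes refl
blue  ≟ᶜ green = no λ ()
green ≟ᶜ red   = no λ ()
green ≟ᶜ blue  = no λ ()
green ≟ᶜ green = yes refl

_≟ᵛ_ : ∀ {k} (u v : Vertex k) → Dec (u ≡ v)
src i ≟ᵛ src j = map′ (cong src) (λ { refl → refl }) (i ≟ᶠ j)
src _ ≟ᵛ tgt _ = no λ ()
src _ ≟ᵛ new _ = no λ ()
tgt _ ≟ᵛ src _ = no λ ()
tgt i ≟ᵛ tgt j = map′ (cong tgt) (λ { refl → refl }) (i ≟ᶠ j)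
tgt _ ≟ᵛ new _ = no λ ()
new _ ≟ᵛ src _ = no λ ()
new _ ≟ᵛ tgt _ = no λ ()
new i ≟ᵛ new j = map′ (cong new) (λ { refl → refl }) (i ≟ᶠ j)

_≟ᵉ_ : ∀ {k} (e e′ : Vertex k × Vertex k × Colour) → Dec (e ≡ e′)
_≟ᵉ_ = ≡-dec _≟ᵛ_ (≡-dec _≟ᵛ_ _≟ᶜ_)

-- Green paths built from items, and the forced edges between them

Green : ∀ {k} → Edges k → Vertex k → Vertex k → Set
Green E u v = (u , v , green) ∈ E ⊎ (v , u , green) ∈ E

green? : ∀ {k} (E : Edges k) u v → Dec (Green E u v)
green? E u v = Any.any? (_ ≟ᵉ_) E ⊎-dec Any.any? (_ ≟ᵉ_) E

jointsFrom : ∀ {k} → Item k → List (Item k) → List (Vertex k × Vertex k)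
jointsFrom x [] = []
jointsFrom x (y ∷ ys) = (exit x , entry y) ∷ jointsFrom y ys

endFrom : ∀ {k} → Item k → List (Item k) → Vertex k
endFrom x [] = exit x
endFrom x (y ∷ ys) = endFrom y ys

joints : ∀ {k} → Path⁺ k → List (Vertex k × Vertex k)
joints (x ∷ xs) = jointsFrom x xs

pathStart pathEnd : ∀ {k} → Path⁺ k → Vertex k
pathStart (x ∷ _) = entry x
pathEnd (x ∷ xs) = endFrom x xs

leafJoints : ∀ {k} (t : Target) → Vec (Path⁺ k) (arity t) → List (Vertex k × Vertex k)
leafJoints finish (p ∷ []) = (pathEnd p , pathStart p) ∷ joints p
leafJoints (reach _) ps = concatMap joints (Vec.toList ps)

-- Nothing is decided here about Painter being forced: as `void` is never `Valid`, an inserted edge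
-- passes the check only if red and blue are both blocked at it.
force : ∀ {k g} {ts : Vec Target g} → Edges k → List (Vertex k × Vertex k) → Tree k ts → Tree k ts
force E [] t = t
force E ((u , v) ∷ js) t with does (green? E u v)
... | true  = force E js t
... | false = offer u v (force ((u , v , green) ∷ E) js t) void void

-- Trees are written without the edges that Painter is forced to colour green;
-- these are inserted in front of the leaves.
complete : ∀ {k g} {ts : Vec Target g} → Edges k → Tree k ts → Tree k ts
complete E (offer u v x y z) = offer u v
  (complete ((u , v , green) ∷ E) x) (complete ((u , v , red) ∷ E) y) (complete ((u , v , blue) ∷ E) z)
complete {ts = ts} E (leaf i s ps) = force E (leafJoints (Vec.lookup ts i) ps) (leaf i s ps)
complete E void = void

-- Decidable correctness of a tree

Differ : ∀ {k} → Item k → Item k → Set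
Differ (fwd i) (fwd j) = i ≢ j
Differ (fwd i) (bwd j) = i ≢ j
Differ (bwd i) (fwd j) = i ≢ j
Differ (bwd i) (bwd j) = i ≢ j
Differ (new m) (new n) = m ≢ n
Differ (new _) (fwd _) = ⊤
Differ (new _) (bwd _) = ⊤
Differ (fwd _) (new _) = ⊤
Differ (bwd _) (new _) = ⊤

differ? : ∀ {k} (x y : Item k) → Dec (Differ x y)
differ? (fwd i) (fwd j) = ¬? (i ≟ᶠ j)
differ? (fwd i) (bwd j) = ¬? (i ≟ᶠ j)
differ? (bwd i) (fwd j) = ¬? (i ≟ᶠ j)
differ? (bwd i) (bwd j) = ¬? (i ≟ᶠ j)
differ? (new m) (new n) = ¬? (m ≟ᶠ n)
differ? (new _) (fwd _) = yes tt
differ? (new _) (bwd _) = yes tt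
differ? (fwd _) (new _) = yes tt
differ? (bwd _) (new _) = yes tt

-- The i-th target is to be reached with exactly r of the D missing vertices
-- still missing and with at least n rounds left, (r , n) being its budget.
module Check {k g : ℕ} (κ : Kind k) (ts : Vec Target g) (budgets : Vec (ℕ × ℕ) g) (D : ℕ) where

  weight : Vertex k → List Colour
  weight (src i) = left (Vec.lookup κ i)
  weight (tgt i) = right (Vec.lookup κ i)
  weight (new _) = []

  Coloured : Edges k → Colour → Vertex k → Set
  Coloured E c v = Any (λ (x , y , d) → d ≡ c × (x ≡ v ⊎ y ≡ v)) E ⊎ c ∈ weight v

  coloured? : ∀ E c v → Dec (Coloured E c v)
  coloured? E c v =
    Any.any? (λ (x , y , d) → d ≟ᶜ c ×-dec (x ≟ᵛ v ⊎-dec y ≟ᵛ v)) E ⊎-dec Any.any? (c ≟ᶜ_) (weight v)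

  Long : Fin k → Set
  Long i = T (long (Vec.lookup κ i))

  -- A sufficient condition for two names to denote different vertices; the two ends of one path may
  -- coincide unless the path is `long`.
  Apart : Vertex k → Vertex k → Set
  Apart (src i) (src j) = i ≢ j
  Apart (tgt i) (tgt j) = i ≢ j
  Apart (src i) (tgt j) = i ≢ j ⊎ Long i
  Apart (tgt i) (src j) = i ≢ j ⊎ Long i
  Apart (new m) (new n) = m ≢ n
  Apart (new _) (src _) = ⊤
  Apart (new _) (tgt _) = ⊤
  Apart (src _) (new _) = ⊤
  Apart (tgt _) (new _) = ⊤

  apart? : ∀ u v → Dec (Apart u v)
  apart? (src i) (src j) = ¬? (i ≟ᶠ j)
  apart? (tgt i) (tgt j) = ¬? (i ≟ᶠ j)
  apart? (src i) (tgt j) = ¬? (i ≟ᶠ j) ⊎-dec T? _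
  apart? (tgt i) (src j) = ¬? (i ≟ᶠ j) ⊎-dec T? _
  apart? (new m) (new n) = ¬? (m ≟ᶠ n)
  apart? (new _) (src _) = yes tt
  apart? (new _) (tgt _) = yes tt
  apart? (src _) (new _) = yes tt
  apart? (tgt _) (new _) = yes tt

  IsNew : Vertex k → Set
  IsNew (new _) = ⊤
  IsNew (src _) = ⊥
  IsNew (tgt _) = ⊥

  isNew? : ∀ v → Dec (IsNew v)
  isNew? (new _) = yes tt
  isNew? (src _) = no id
  isNew? (tgt _) = no id

  -- A new end rules out all edges drawn before the tree began, so only the edges of the tree itself
  -- are compared, in both orientations. Two old path ends are therefore never joined directly, only
  -- through new vertices.
  Free : Edges k → Vertex k → Vertex k → Set
  Free E u v = (IsNew u ⊎ IsNew v) × Apart u v ×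
    All (λ (x , y , _) → (Apart u x ⊎ Apart v y) × (Apart u y ⊎ Apart v x)) E

  free? : ∀ E u v → Dec (Free E u v)
  free? E u v = (isNew? u ⊎-dec isNew? v) ×-dec apart? u v ×-dec
    All.all? (λ (x , y , _) → (apart? u x ⊎-dec apart? v y) ×-dec (apart? u y ⊎-dec apart? v x)) E

  LongPath : Path⁺ k → Set
  LongPath (_ ∷ _ ∷ _) = ⊤
  LongPath (fwd i ∷ []) = Long i
  LongPath (bwd i ∷ []) = Long i
  LongPath (new _ ∷ []) = ⊥

  longPath? : ∀ p → Dec (LongPath p)
  longPath? (_ ∷ _ ∷ _) = yes tt
  longPath? (fwd i ∷ []) = T? _
  longPath? (bwd i ∷ []) = T? _
  longPath? (new _ ∷ []) = no id

  Ends : Edges k → Bool → SegmentKind → Path⁺ k → Set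
  Ends E s σ p = All (λ c → Coloured E (paint s c) (pathStart p)) (left σ)
               × All (λ c → Coloured E (paint s c) (pathEnd p)) (right σ)
               × (long σ ≡ false ⊎ LongPath p)

  ends? : ∀ E s σ p → Dec (Ends E s σ p)
  ends? E s σ p = All.all? (λ _ → coloured? E _ _) (left σ) ×-dec All.all? (λ _ → coloured? E _ _) (right σ)
    ×-dec (long σ Boolₚ.≟ false ⊎-dec longPath? p)

  total : ∀ {k′} → Vec (Path⁺ k) k′ → ℕ
  total {k′} ps = sum (map (λ j → added (toList (Vec.lookup ps j))) (allFin k′))

  -- Equality with `allFin k` makes every long path occur exactly once, so no old vertex is dropped
  -- and the size of the result can be computed. New vertices may be dropped.
  Arranged : ∀ {k′} → Edges k → Vec (Path⁺ k) k′ → Set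
  Arranged {k′} E ps =
      concatMap (λ j → segments (toList (Vec.lookup ps j))) (allFin k′) ≡ allFin k
    × (∀ j → AllPairs Differ (toList (Vec.lookup ps j)))
    × (∀ i j → i ≡ j ⊎ All (λ x → All (Differ x) (toList (Vec.lookup ps j))) (toList (Vec.lookup ps i)))
    × (∀ j → All (λ (u , v) → Green E u v) (joints (Vec.lookup ps j)))

  arranged? : ∀ {k′} E (ps : Vec (Path⁺ k) k′) → Dec (Arranged E ps)
  arranged? E ps =
      Listₚ.≡-dec _≟ᶠ_ _ _
    ×-dec all? (λ j → allPairs? differ? (toList (Vec.lookup ps j)))
    ×-dec all? (λ i → all? λ j → i ≟ᶠ j ⊎-dec
            All.all? (λ x → All.all? (differ? x) (toList (Vec.lookup ps j))) (toList (Vec.lookup ps i)))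
    ×-dec all? (λ j → All.all? (λ (u , v) → green? E u v) (joints (Vec.lookup ps j)))

  LeafOK : (t : Target) → ℕ × ℕ → ℕ → Edges k → Bool → Vec (Path⁺ k) (arity t) → Set
  LeafOK finish _ f E s (p ∷ []) =
    Arranged E (p ∷ []) × total (p ∷ []) ≡ D × Green E (pathEnd p) (pathStart p)
  LeafOK (reach κ′) (r , n) f E s ps =
    Arranged E ps × r + total ps ≡ D × n ≤ f × (∀ j → Ends E s (Vec.lookup κ′ j) (Vec.lookup ps j))

  leafOK? : ∀ t b f E s ps → Dec (LeafOK t b f E s ps)
  leafOK? finish _ f E s (p ∷ []) =
    arranged? E (p ∷ []) ×-dec (_ ≟ⁿ _) ×-dec green? E (pathEnd p) (pathStart p)
  leafOK? (reach κ′) (r , n) f E s ps =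
    arranged? E ps ×-dec (_ ≟ⁿ _) ×-dec n ≤ⁿ? f ×-dec all? (λ j → ends? E s (Vec.lookup κ′ j) (Vec.lookup ps j))

  Blocked : Edges k → Colour → Vertex k → Vertex k → Set
  Blocked E c u v = Coloured E c u ⊎ Coloured E c v

  -- Here `f` counts the rounds left to the tree. A red or blue answer needs a continuation only
  -- where it does not complete a monochromatic `Path 3`.
  Valid : ℕ → Edges k → Tree k ts → Set
  Valid f E (leaf i s ps) = LeafOK (Vec.lookup ts i) (Vec.lookup budgets i) f E s ps
  Valid f E void = ⊥
  Valid zero E (offer _ _ _ _ _) = ⊥
  Valid (suc f) E (offer u v x y z) = Free E u v
    × Valid f ((u , v , green) ∷ E) x
    × (Blocked E red u v ⊎ Valid f ((u , v , red) ∷ E) y)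
    × (Blocked E blue u v ⊎ Valid f ((u , v , blue) ∷ E) z)

  valid? : ∀ f E t → Dec (Valid f E t)
  valid? f E (leaf i s ps) = leafOK? (Vec.lookup ts i) (Vec.lookup budgets i) f E s ps
  valid? f E void = no id
  valid? zero E (offer _ _ _ _ _) = no id
  valid? (suc f) E (offer u v x y z) = free? E u v
    ×-dec valid? f _ x
    ×-dec ((coloured? E red u ⊎-dec coloured? E red v) ⊎-dec valid? f _ y)
    ×-dec ((coloured? E blue u ⊎-dec coloured? E blue v) ⊎-dec valid? f _ z)

-- Positions between trees, and winning from them

record State {k : ℕ} (κ : Kind k) (B : Board) (m : ℕ) : Set where
  field
    N       : ℕ
    below   : All (λ (u , v , _) → u < N × v < N) B
    swapped : Bool
    first last : Fin k → ℕ
    vs      : Fin k → List ℕ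
    walk    : ∀ i → Walk B (first i) (vs i) (last i)
    unique  : ∀ i → Unique (vs i)
    disjoint : ∀ {i j} → i ≢ j → Disjoint (vs i) (vs j)
    inside  : ∀ i → All (_< N) (vs i)
    leftColours  : ∀ i → All (λ c → Touches B (paint swapped c) (first i)) (left (Vec.lookup κ i))
    rightColours : ∀ i → All (λ c → Touches B (paint swapped c) (last i)) (right (Vec.lookup κ i))
    ends≢   : ∀ i → T (long (Vec.lookup κ i)) → first i ≢ last i
    size    : sum (map (length ∘ vs) (allFin k)) ≡ m

-- Here r is the number of vertices that the green paths still lack.
Win : ∀ {k} → ℕ → Kind k → ℕ → ℕ → Set
Win l κ r n = ∀ {B m} → State κ B m → m + r ≡ l → BuilderWinsWithin (Path 3) (Path 3) (Cycle l) n B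

Met : ℕ → ℕ → ℕ → Target → ℕ × ℕ → Set
-- The tree itself adds `D` vertices, so the cycle has length exactly `l` only if no further `r₀`
-- are missing.
Met l r₀ n₀ finish _ = r₀ ≡ 0
Met l r₀ n₀ (reach κ) (r , n) = Win l κ (r + r₀) (n + n₀)

AllMet : ∀ {g} → ℕ → ℕ → ℕ → Vec Target g → Vec (ℕ × ℕ) g → Set
AllMet l r₀ n₀ [] [] = ⊤
AllMet l r₀ n₀ (t ∷ ts) (b ∷ bs) = Met l r₀ n₀ t b × AllMet l r₀ n₀ ts bs

met-lookup : ∀ {g l r₀ n₀} (ts : Vec Target g) bs → AllMet l r₀ n₀ ts bs →
             ∀ i → Met l r₀ n₀ (Vec.lookup ts i) (Vec.lookup bs i)
met-lookup (_ ∷ _) (_ ∷ _) (p , _) zero = p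
met-lookup (_ ∷ ts) (_ ∷ bs) (_ , ps) (suc i) = met-lookup ts bs ps i

-- Soundness: a valid tree is a strategy on the board

module Sound {k g : ℕ} {κ : Kind k} {ts : Vec Target g} {budgets : Vec (ℕ × ℕ) g} {D l : ℕ}
             (r₀ n₀ : ℕ) (met : ∀ i → Met l r₀ n₀ (Vec.lookup ts i) (Vec.lookup budgets i))
             {B₀ : Board} {m : ℕ} (st : State κ B₀ m) (m+r≡l : m + (D + r₀) ≡ l) where

  open Check κ ts budgets D
  open State st

  ρ : Vertex k → ℕ
  ρ (src i) = first i
  ρ (tgt i) = last i
  ρ (new n) = N + toℕ n

  embed : Vertex k × Vertex k × Colour → ColouredEdge
  embed (u , v , c) = ρ u , ρ v , paint swapped c

  board : Edges k → Board
  board E = map embed E ++ B₀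

  first<N : ∀ i → first i < N
  first<N i = All.lookup (inside i) (first∈ (walk i))

  last<N : ∀ i → last i < N
  last<N i = All.lookup (inside i) (last∈ (walk i))

  old≢new : ∀ {x} n → x < N → x ≢ N + n
  old≢new n x<N refl = <-irrefl refl (<-≤-trans x<N (m≤m+n N n))

  ρ< : ∀ v → ρ v < N + 8
  ρ< (src i) = <-≤-trans (first<N i) (m≤m+n N 8)
  ρ< (tgt i) = <-≤-trans (last<N i) (m≤m+n N 8)
  ρ< (new n) = +-monoʳ-< N (toℕ<n n)

  apart⇒≢ : ∀ u v → Apart u v → ρ u ≢ ρ v
  apart⇒≢ (src i) (src j) i≢j eq = disjoint i≢j (subst (_∈ vs i) eq (first∈ (walk i)) , first∈ (walk j))
  apart⇒≢ (tgt i) (tgt j) i≢j eq = disjoint i≢j (subst (_∈ vs i) eq (last∈ (walk i)) , last∈ (walk j))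
  apart⇒≢ (src i) (tgt j) a eq with i ≟ᶠ j
  ... | no i≢j = disjoint i≢j (subst (_∈ vs i) eq (first∈ (walk i)) , last∈ (walk j))
  ... | yes refl = Sum.[ (λ i≢i → i≢i refl) , (λ lg → ends≢ i lg eq) ] a
  apart⇒≢ (tgt i) (src j) a eq with i ≟ᶠ j
  ... | no i≢j = disjoint i≢j (subst (_∈ vs i) eq (last∈ (walk i)) , first∈ (walk j))
  ... | yes refl = Sum.[ (λ i≢i → i≢i refl) , (λ lg → ends≢ i lg (sym eq)) ] a
  apart⇒≢ (new i) (new j) i≢j eq = i≢j (toℕ-injective (+-cancelˡ-≡ N _ _ eq))
  apart⇒≢ (new n) (src i) _ eq = old≢new (toℕ n) (first<N i) (sym eq)
  apart⇒≢ (new n) (tgt i) _ eq = old≢new (toℕ n) (last<N i) (sym eq)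
  apart⇒≢ (src i) (new n) _ eq = old≢new (toℕ n) (first<N i) eq
  apart⇒≢ (tgt i) (new n) _ eq = old≢new (toℕ n) (last<N i) eq

  isNew⇒≮ : ∀ v → IsNew v → ¬ ρ v < N
  isNew⇒≮ (new n) _ lt = old≢new (toℕ n) lt refl

  -- An edge from before the tree has both ends below `N`, which a new vertex is not; an edge of the
  -- tree differs from the pair in at least one end.
  free⇒¬edge : ∀ {E} u v → Free E u v → ∀ c → ¬ ((ρ u , ρ v , c) ∈ board E)
  free⇒¬edge {E} u v (fresh , _ , clear) c e with ∈-++⁻ (map embed E) e
  ... | inj₂ old with All.lookup below old
  ...   | u<N , v<N = Sum.[ (λ p → isNew⇒≮ u p u<N) , (λ p → isNew⇒≮ v p v<N) ] fresh
  free⇒¬edge {E} u v (fresh , _ , clear) c e | inj₁ loc with ∈-map⁻ embed loc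
  ... | (x , y , d) , e∈ , eq = Sum.[ (λ a → apart⇒≢ u x a (cong proj₁ eq))
                                    , (λ a → apart⇒≢ v y a (cong (proj₁ ∘ proj₂) eq)) ]
                                    (proj₁ (All.lookup clear e∈))

  apart-sym : ∀ u v → Apart u v → Apart v u
  apart-sym (src i) (src j) a = a ∘ sym
  apart-sym (tgt i) (tgt j) a = a ∘ sym
  apart-sym (src i) (tgt j) a with i ≟ᶠ j
  ... | yes refl = a
  ... | no i≢j = inj₁ (i≢j ∘ sym)
  apart-sym (tgt i) (src j) a with i ≟ᶠ j
  ... | yes refl = a
  ... | no i≢j = inj₁ (i≢j ∘ sym)
  apart-sym (new m) (new n) a = a ∘ sym
  apart-sym (new _) (src _) _ = tt
  apart-sym (new _) (tgt _) _ = tt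
  apart-sym (src _) (new _) _ = tt
  apart-sym (tgt _) (new _) _ = tt

  free-sym : ∀ {E} u v → Free E u v → Free E v u
  free-sym u v (fresh , a , clear) =
    Sum.swap fresh , apart-sym u v a , All.map (λ (p , q) → Sum.swap q , Sum.swap p) clear

  free⇒¬adjacent : ∀ {E} u v → Free E u v → ¬ Adjacent (board E) (ρ u) (ρ v)
  free⇒¬adjacent u v fr (c , inj₁ e) = free⇒¬edge u v fr c e
  free⇒¬adjacent {E} u v fr (c , inj₂ e) = free⇒¬edge v u (free-sym {E} u v fr) c e

  Proper : Edges k → Set
  Proper = All (λ (u , v , _) → ρ u ≢ ρ v)

  old⊆ : ∀ E {e} → e ∈ B₀ → e ∈ board E
  old⊆ E = ∈-++⁺ʳ (map embed E)

  local⊆ : ∀ {E e} → e ∈ E → embed e ∈ board E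
  local⊆ e∈ = ∈-++⁺ˡ (∈-map⁺ embed e∈)

  weight⇒touches : ∀ {c} v → c ∈ weight v → Touches B₀ (paint swapped c) (ρ v)
  weight⇒touches (src i) c∈ = All.lookup (leftColours i) c∈
  weight⇒touches (tgt i) c∈ = All.lookup (rightColours i) c∈

  coloured⇒touches : ∀ {E} c v → Proper E → Coloured E c v → Touches (board E) (paint swapped c) (ρ v)
  coloured⇒touches {E} c v pr (inj₂ c∈) = touches-mono (old⊆ E) (weight⇒touches v c∈)
  coloured⇒touches {E} c v pr (inj₁ found) with find found
  ... | (x , y , _) , e∈ , refl , inj₁ refl = ρ y , All.lookup pr e∈ , inj₁ (local⊆ e∈)
  ... | (x , y , _) , e∈ , refl , inj₂ refl = ρ x , All.lookup pr e∈ ∘ sym , inj₂ (local⊆ e∈)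

  green⇒edge : ∀ {E} u v → Green E u v → HasEdge (board E) green (ρ u) (ρ v)
  green⇒edge {E} u v = Sum.map (recolour u v ∘ local⊆) (recolour v u ∘ local⊆)
    where
    recolour : ∀ x y → (ρ x , ρ y , paint swapped green) ∈ board E → (ρ x , ρ y , green) ∈ board E
    recolour x y = subst (λ c → (ρ x , ρ y , c) ∈ board E) (paint-green swapped)

  expand : Item k → List ℕ
  expand (fwd i) = vs i
  expand (bwd i) = reverse (vs i)
  expand (new n) = (N + toℕ n) ∷ []

  expandAll : List (Item k) → List ℕ
  expandAll = concatMap expand

  expand-walk : ∀ E x → Walk (board E) (ρ (entry x)) (expand x) (ρ (exit x))
  expand-walk E (fwd i) = walk-mono (old⊆ E) (walk i)
  expand-walk E (bwd i) = walk-mono (old⊆ E) (walk-reverse (walk i))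
  expand-walk E (new n) = stay

  path-walk : ∀ {E} x xs → All (λ (u , v) → Green E u v) (jointsFrom x xs) →
              Walk (board E) (ρ (entry x)) (expandAll (x ∷ xs)) (ρ (endFrom x xs))
  path-walk {E} x [] [] = subst (λ ys → Walk (board E) (ρ (entry x)) ys (ρ (exit x)))
    (sym (Listₚ.++-identityʳ (expand x))) (expand-walk E x)
  path-walk {E} x (y ∷ ys) (j ∷ js) = walk-++ (expand-walk E x) (green⇒edge (exit x) (entry y) j) (path-walk y ys js)

  expand-unique : ∀ x → Unique (expand x)
  expand-unique (fwd i) = unique i
  expand-unique (bwd i) = unique-reverse (unique i)
  expand-unique (new n) = [] ∷ []

  fresh∉ : ∀ {x} i (n : Fin 8) → x ∈ vs i → x ∈ (N + toℕ n) ∷ [] → ⊥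
  fresh∉ i n x∈ (here refl) = old≢new (toℕ n) (All.lookup (inside i) x∈) refl

  expand-disjoint : ∀ x y → Differ x y → Disjoint (expand x) (expand y)
  expand-disjoint (fwd i) (fwd j) i≢j = disjoint i≢j
  expand-disjoint (fwd i) (bwd j) i≢j (p , q) = disjoint i≢j (p , Anyₚ.reverse⁻ q)
  expand-disjoint (bwd i) (fwd j) i≢j (p , q) = disjoint i≢j (Anyₚ.reverse⁻ p , q)
  expand-disjoint (bwd i) (bwd j) i≢j (p , q) = disjoint i≢j (Anyₚ.reverse⁻ p , Anyₚ.reverse⁻ q)
  expand-disjoint (new i) (new j) i≢j (here refl , here eq) = i≢j (toℕ-injective (+-cancelˡ-≡ N _ _ eq))
  expand-disjoint (new n) (fwd i) _ (p , q) = fresh∉ i n q p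
  expand-disjoint (new n) (bwd i) _ (p , q) = fresh∉ i n (Anyₚ.reverse⁻ q) p
  expand-disjoint (fwd i) (new n) _ (p , q) = fresh∉ i n p q
  expand-disjoint (bwd i) (new n) _ (p , q) = fresh∉ i n (Anyₚ.reverse⁻ p) q

  expandAll-unique : ∀ {xs} → AllPairs Differ xs → Unique (expandAll xs)
  expandAll-unique {xs} ds = Uniqueₚ.concat⁺ (Allₚ.map⁺ (All.universal expand-unique xs))
    (AllPairsₚ.map⁺ (AllPairs.map (λ {x} {y} → expand-disjoint x y) ds))

  ∈-expandAll⁻ : ∀ {v} xs → v ∈ expandAll xs → ∃ λ x → x ∈ xs × v ∈ expand x
  ∈-expandAll⁻ xs v∈ = find (Anyₚ.map⁻ (Anyₚ.concat⁻ (map expand xs) v∈))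

  expandAll-disjoint : ∀ {xs ys} → All (λ x → All (Differ x) ys) xs → Disjoint (expandAll xs) (expandAll ys)
  expandAll-disjoint {xs} {ys} ds (p , q) with ∈-expandAll⁻ xs p | ∈-expandAll⁻ ys q
  ... | x , x∈ , v∈x | y , y∈ , v∈y = expand-disjoint x y (All.lookup (All.lookup ds x∈) y∈) (v∈x , v∈y)

  expand< : ∀ x → All (_< N + 8) (expand x)
  expand< (fwd i) = All.map (λ lt → <-≤-trans lt (m≤m+n N 8)) (inside i)
  expand< (bwd i) = All.tabulate (λ x∈ → All.lookup (expand< (fwd i)) (Anyₚ.reverse⁻ x∈))
  expand< (new n) = ρ< (new n) ∷ []

  expandAll< : ∀ xs → All (_< N + 8) (expandAll xs)
  expandAll< xs = Allₚ.concat⁺ (Allₚ.map⁺ (All.universal expand< xs))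

  oldSize : List (Fin k) → ℕ
  oldSize is = sum (map (length ∘ vs) is)

  length-expandAll : ∀ xs → length (expandAll xs) ≡ oldSize (segments xs) + added xs
  length-expandAll [] = refl
  length-expandAll (fwd i ∷ xs) rewrite length-++ (vs i) {expandAll xs} | length-expandAll xs =
    sym (+-assoc (length (vs i)) _ _)
  length-expandAll (bwd i ∷ xs)
    rewrite length-++ (reverse (vs i)) {expandAll xs} | length-expandAll xs | length-reverse (vs i) =
    sym (+-assoc (length (vs i)) _ _)
  length-expandAll (new n ∷ xs) rewrite length-expandAll xs = sym (+-suc _ _)

  module _ {k′ : ℕ} (ps : Vec (Path⁺ k) k′) where

    items : Fin k′ → List (Item k)
    items j = toList (Vec.lookup ps j)

    size-expandAll : ∀ js → sum (map (length ∘ expandAll ∘ items) js) ≡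
                     oldSize (concatMap (segments ∘ items) js) + sum (map (added ∘ items) js)
    size-expandAll [] = refl
    size-expandAll (j ∷ js)
      rewrite length-expandAll (items j) | size-expandAll js
            | map-++ (length ∘ vs) (segments (items j)) (concatMap (segments ∘ items) js)
            | sum-++ (map (length ∘ vs) (segments (items j))) (map (length ∘ vs) (concatMap (segments ∘ items) js)) =
      rearrange (oldSize (segments (items j))) (added (items j))
                (oldSize (concatMap (segments ∘ items) js)) (sum (map (added ∘ items) js))
      where
      rearrange : ∀ a b c d → (a + b) + (c + d) ≡ (a + c) + (b + d)
      rearrange = solve-∀

    arranged-size : ∀ {E} → Arranged E ps → sum (map (length ∘ expandAll ∘ items) (allFin k′)) ≡ m + total ps
    arranged-size (segs , _) = trans (size-expandAll (allFin k′))
      (cong (_+ total ps) (trans (cong oldSize segs) size))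

    -- With two or more items, the start lies in the first item and the end in the later ones, and
    -- these have no vertex in common.
    longPath⇒≢ : ∀ {E} p → AllPairs Differ (toList p) → All (λ (u , v) → Green E u v) (joints p) →
                 LongPath p → ρ (pathStart p) ≢ ρ (pathEnd p)
    longPath⇒≢ (fwd i ∷ []) _ _ lg = ends≢ i lg
    longPath⇒≢ (bwd i ∷ []) _ _ lg = ends≢ i lg ∘ sym
    longPath⇒≢ {E} (x ∷ y ∷ ys) (ds ∷ _) (_ ∷ js) _ eq =
      expandAll-disjoint {x ∷ []} {y ∷ ys} (ds ∷ [])
        ( subst (_∈ expandAll (x ∷ [])) eq (first∈ (path-walk {E} x [] []))
        , last∈ (path-walk {E} y ys js) )

    next : ∀ {E} s {κ′ : Kind k′} → Proper E → Arranged E ps →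
           (∀ j → Ends E s (Vec.lookup κ′ j) (Vec.lookup ps j)) → State κ′ (board E) (m + total ps)
    next {E} s {κ′} pr arr@(_ , diff , cross , linked) ends = record
      { N = N + 8
      ; below = Allₚ.++⁺ (Allₚ.map⁺ (All.universal (λ (u , v , _) → ρ< u , ρ< v) E))
                         (All.map (λ (p , q) → <-≤-trans p (m≤m+n N 8) , <-≤-trans q (m≤m+n N 8)) below)
      -- The exchange at the leaf is relative to the colours of the tree, which may already be
      -- exchanged on the board.
      ; swapped = swapped xor s
      ; first = λ j → ρ (pathStart (Vec.lookup ps j))
      ; last = λ j → ρ (pathEnd (Vec.lookup ps j))
      ; vs = λ j → expandAll (items j)
      ; walk = λ j → walk′ (Vec.lookup ps j) (linked j)
      ; unique = λ j → expandAll-unique (diff j)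
      ; disjoint = λ {i} {j} i≢j → Sum.[ (λ i≡j → contradiction i≡j i≢j) , (λ ds → expandAll-disjoint ds) ] (cross i j)
      ; inside = λ j → expandAll< (items j)
      ; leftColours = λ j → All.map (λ {c} → recolour c (pathStart (Vec.lookup ps j))) (proj₁ (ends j))
      ; rightColours = λ j → All.map (λ {c} → recolour c (pathEnd (Vec.lookup ps j))) (proj₁ (proj₂ (ends j)))
      ; ends≢ = λ j lg → longPath⇒≢ {E} (Vec.lookup ps j) (diff j) (linked j) (isLong lg (proj₂ (proj₂ (ends j))))
      ; size = arranged-size {E} arr
      }
      where
      walk′ : ∀ p → All (λ (u , v) → Green E u v) (joints p) →
              Walk (board E) (ρ (pathStart p)) (expandAll (toList p)) (ρ (pathEnd p))
      walk′ (x ∷ xs) = path-walk x xs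
      recolour : ∀ c v → Coloured E (paint s c) v → Touches (board E) (paint (swapped xor s) c) (ρ v)
      recolour c v col = subst (λ d → Touches (board E) d (ρ v)) (sym (paint-xor swapped s c))
        (coloured⇒touches (paint s c) v pr col)
      isLong : ∀ {b} {P : Set} → T b → b ≡ false ⊎ P → P
      isLong tb (inj₁ refl) = ⊥-elim tb
      isLong tb (inj₂ p) = p

  closes : ∀ {E} p → r₀ ≡ 0 → Arranged E (p ∷ []) → total (p ∷ []) ≡ D → Green E (pathEnd p) (pathStart p) →
           HasMonoCopy (board E) green (Cycle l)
  closes {E} p@(x ∷ xs) refl arr@(_ , diff , _ , linked) tot gr =
    subst (λ n → HasMonoCopy (board E) green (Cycle n)) len
      (walk-cycle (path-walk x xs (linked 0F)) (expandAll-unique (diff 0F)) (green⇒edge (pathEnd p) (pathStart p) gr))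
    where
    len : length (expandAll (toList p)) ≡ l
    len = trans (sym (+-identityʳ _)) (trans (arranged-size (p ∷ []) {E} arr)
            (trans (cong (m +_) (trans tot (sym (+-identityʳ D)))) m+r≡l))

  Goal : ℕ → Board → Set
  Goal = BuilderWinsWithin (Path 3) (Path 3) (Cycle l)

  arrive : ∀ t b → Met l r₀ n₀ t b → ∀ f E s ps → Proper E → LeafOK t b f E s ps → Goal (f + n₀) (board E)
  arrive finish b r₀≡0 f E s (p ∷ []) pr (arr , tot , gr) = won (inj₂ (inj₂ (closes p r₀≡0 arr tot gr)))
  arrive (reach κ′) (r , n) win f E s ps pr (arr , tot , n≤f , ends) =
    wins-mono (+-monoˡ-≤ n₀ n≤f) (win (next ps s pr arr ends)
      (trans (shift m (total ps) r r₀) (trans (cong (λ d → m + (d + r₀)) tot) m+r≡l)))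
    where
    shift : ∀ a b c d → (a + b) + (c + d) ≡ a + ((c + b) + d)
    shift = solve-∀

  lose : ∀ {B n u v} c → c ≢ green → u ≢ v → ¬ Adjacent B u v → Touches B c u ⊎ Touches B c v →
         Goal n ((u , v , c) ∷ B)
  lose red _ u≢v fr t = won (inj₁ (path₃-new u≢v fr t))
  lose blue _ u≢v fr t = won (inj₂ (inj₁ (path₃-new u≢v fr t)))
  lose green c≢g _ _ _ = contradiction refl c≢g

  paint-≢green : ∀ {c} → c ≢ green → paint swapped c ≢ green
  paint-≢green {c} c≢g eq = c≢g (trans (sym (paint-involutive swapped c)) (trans (cong (paint swapped) eq) (paint-green swapped)))

  sound : ∀ f E t → Proper E → Valid f E t → Goal (f + n₀) (board E)
  sound f E (leaf i s ps) pr ok = arrive (Vec.lookup ts i) (Vec.lookup budgets i) (met i) f E s ps pr ok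
  sound (suc f) E (offer u v x y z) pr (fr@(_ , a , _) , okx , oky , okz) =
    -- Painter's colour is translated into the tree's by `paint swapped`; translating twice restores
    -- the colour on the board.
    move (ρ u) (ρ v) u≢v nonadj λ c → subst (λ c → Goal (f + n₀) ((ρ u , ρ v , c) ∷ board E))
      (paint-involutive swapped c) (answer (paint swapped c))
    where
    u≢v : ρ u ≢ ρ v
    u≢v = apart⇒≢ u v a
    nonadj : ¬ Adjacent (board E) (ρ u) (ρ v)
    nonadj = free⇒¬adjacent u v fr
    continue : ∀ c t → c ≢ green → Blocked E c u v ⊎ Valid f ((u , v , c) ∷ E) t →
               Goal (f + n₀) ((ρ u , ρ v , paint swapped c) ∷ board E)
    continue c t c≢g (inj₁ bl) = lose (paint swapped c) (paint-≢green c≢g) u≢v nonadj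
      (Sum.map (coloured⇒touches c u pr) (coloured⇒touches c v pr) bl)
    continue c t _ (inj₂ ok) = sound f ((u , v , c) ∷ E) t (u≢v ∷ pr) ok
    answer : ∀ c → Goal (f + n₀) ((ρ u , ρ v , paint swapped c) ∷ board E)
    answer red = continue red y (λ ()) oky
    answer blue = continue blue z (λ ()) okz
    answer green = sound f ((u , v , green) ∷ E) x (u≢v ∷ pr) okx

-- The check is evaluated on the numerals `D` and `C` and the budgets only. The amounts `r₀` and
-- `n₀` are added to both sides afterwards, so a single evaluation serves all members of a family
-- indexed by `j`.
play : ∀ {k g} {κ : Kind k} {ts : Vec Target g} (budgets : Vec (ℕ × ℕ) g) (D C : ℕ) (t : Tree k ts) →
       {True (Check.valid? κ ts budgets D C [] (complete [] t))} → ∀ {l} r₀ n₀ →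
       AllMet l r₀ n₀ ts budgets → Win l κ (D + r₀) (C + n₀)
play {ts = ts} budgets D C t {ok} r₀ n₀ met st eq =
  Sound.sound r₀ n₀ (met-lookup ts budgets met) st eq C [] (complete [] t) [] (toWitness ok)

-- The strategy

pattern a  = src 0F
pattern b  = tgt 0F
pattern a′ = src 1F
pattern b′ = tgt 1F
pattern P  = fwd 0F
pattern P⁻ = bwd 0F
pattern Q  = fwd 1F
pattern Q⁻ = bwd 1F
pattern v₀ = new 0F
pattern v₁ = new 1F
pattern v₂ = new 2F
pattern v₃ = new 3F

pattern goto i s p = leaf i s (p ∷ [])

-- The names of kinds show the colours at the ends: S for red and blue, R, B
-- or ½ for one of them, 0 or O for none.
both : List Colour
both = red ∷ blue ∷ []

S½ S0 BB RB ½0 OO : Kind 1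
S½ = segment both (blue ∷ []) true ∷ []
S0 = segment both [] true ∷ []
BB = segment (blue ∷ []) (blue ∷ []) true ∷ []
RB = segment (red ∷ []) (blue ∷ []) true ∷ []
½0 = segment (blue ∷ []) [] true ∷ []
OO = segment [] [] true ∷ []

-- The first segment may consist of a single vertex.
SS∣RB : Kind 2
SS∣RB = segment both both false ∷ RB

-- Trees for a path with an end meeting both colours

closeS½ : Tree 1 (finish ∷ [])
closeS½ =
  offer b v₀
    (goto 0F false (P ∷ v₀ ∷ []))
    (goto 0F false (P ∷ v₁ ∷ [])) void

growS½ : Tree 1 (reach S0 ∷ reach S½ ∷ [])
growS½ =
  offer b v₀
    (goto 0F false (P ∷ v₀ ∷ []))
    -- Now `b` meets both colours and `v₀` meets red, so the path is turned round: `a` is joined to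
    -- `v₀`, and `b` becomes the end with both.
    (goto 1F true (P⁻ ∷ v₀ ∷ [])) void

-- In the typical tight line, one of `v₀`, `v₁`, `v₂` ends up meeting both colours and heads the new
-- path, linked to `a` through `v₃`; the other two, one meeting red and one blue, follow `b`. This
-- gains four vertices in six rounds. Targets of equal kind differ in their budgets.
fourS½ : Tree 1 (reach S0 ∷ reach S½ ∷ reach S½ ∷ [])
fourS½ =
  offer v₀ v₁
    (offer v₀ v₂
      (offer b v₁
        (goto 0F false (P ∷ v₁ ∷ v₀ ∷ v₂ ∷ []))
        (goto 1F true (P ∷ v₂ ∷ v₀ ∷ v₁ ∷ [])) void)
      (offer v₁ v₂
        (goto 1F true (P ∷ v₀ ∷ v₁ ∷ v₂ ∷ [])) void
        (goto 2F false (v₂ ∷ v₃ ∷ P ∷ v₀ ∷ v₁ ∷ [])))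
      (offer v₁ v₂
        (offer b v₀
          (goto 1F false (P ∷ v₀ ∷ v₁ ∷ v₂ ∷ []))
          (goto 2F false (P ∷ v₃ ∷ v₀ ∷ v₁ ∷ v₂ ∷ [])) void)
        (goto 2F false (v₂ ∷ v₃ ∷ P ∷ v₁ ∷ v₀ ∷ [])) void))
    (offer v₀ v₂
      (offer v₁ v₂
        (goto 1F true (P ∷ v₀ ∷ v₂ ∷ v₁ ∷ [])) void
        (goto 2F false (v₁ ∷ v₃ ∷ P ∷ v₀ ∷ v₂ ∷ []))) void
      (goto 2F false (v₀ ∷ v₃ ∷ P ∷ v₁ ∷ v₂ ∷ [])))
    (offer v₀ v₂
      (offer v₁ v₂
        (offer b v₀
          (goto 1F false (P ∷ v₀ ∷ v₂ ∷ v₁ ∷ []))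
          (goto 2F false (P ∷ v₃ ∷ v₀ ∷ v₂ ∷ v₁ ∷ [])) void)
        (goto 2F false (v₁ ∷ v₃ ∷ P ∷ v₂ ∷ v₀ ∷ [])) void)
      (goto 2F false (v₀ ∷ v₃ ∷ P ∷ v₂ ∷ v₁ ∷ [])) void)

-- A variant without the linking vertex: its tight lines gain three vertices in five rounds and lead
-- from `S½₄` to `S½₁`.
threeS½ : Tree 1 (reach S0 ∷ reach S½ ∷ reach S½ ∷ [])
threeS½ =
  offer v₀ v₁
    (offer b v₀
      (goto 0F false (P ∷ v₀ ∷ v₁ ∷ []))
      (goto 1F true (P ∷ v₁ ∷ v₀ ∷ [])) void)
    (offer v₀ v₂
      (offer v₁ v₂
        (goto 2F true (P ∷ v₀ ∷ v₂ ∷ v₁ ∷ [])) void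
        (goto 2F true (v₁ ∷ P⁻ ∷ v₂ ∷ v₀ ∷ []))) void
      (goto 2F false (v₀ ∷ P ∷ v₁ ∷ v₂ ∷ [])))
    (offer b v₂
      (offer v₀ v₂
        (goto 1F false (P ∷ v₂ ∷ v₀ ∷ []))
        (goto 2F false (v₀ ∷ P ∷ v₂ ∷ v₁ ∷ [])) void)
      (goto 2F false (P ∷ v₀ ∷ v₂ ∷ v₁ ∷ [])) void)

closeS0 : Tree 1 (finish ∷ reach S½ ∷ [])
closeS0 =
  offer b v₀
    (goto 0F false (P ∷ v₀ ∷ []))
    -- The vertex `v₀` is abandoned: the wasted edge has bought a colour at `b`.
    (goto 1F true (P ∷ []))
    (goto 1F false (P ∷ []))

growS0 : Tree 1 (reach S0 ∷ reach S½ ∷ [])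
growS0 =
  offer b v₀
    (goto 0F false (P ∷ v₀ ∷ []))
    (goto 1F true (P ∷ []))
    (goto 1F false (P ∷ []))

-- Trees for a path with at most one colour at each end

closeBB : Tree 1 (finish ∷ reach S½ ∷ [])
closeBB =
  offer a v₀
    (offer b v₀
      (goto 0F false (P ∷ v₀ ∷ []))
      (goto 1F false (P⁻ ∷ [])) void)
    (goto 1F false (P ∷ [])) void

growBB : Tree 1 (reach ½0 ∷ reach S½ ∷ [])
growBB =
  offer a v₀
    (goto 0F false (P⁻ ∷ v₀ ∷ []))
    (goto 1F false (P ∷ [])) void

threeBB : Tree 1 (reach ½0 ∷ reach RB ∷ reach S½ ∷ reach BB ∷ reach S0 ∷ [])
threeBB =
  offer v₀ v₁
    (offer a v₂
      (offer v₀ v₂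
        (goto 0F false (P⁻ ∷ v₂ ∷ v₀ ∷ v₁ ∷ []))
        (offer v₁ v₂
          (goto 1F false (v₀ ∷ v₁ ∷ v₂ ∷ P ∷ [])) void
          (goto 2F false (v₂ ∷ P ∷ v₀ ∷ v₁ ∷ [])))
        (offer b v₁
          (goto 3F false (v₂ ∷ P ∷ v₁ ∷ v₀ ∷ []))
          (goto 2F false (P⁻ ∷ v₂ ∷ v₁ ∷ v₀ ∷ [])) void))
      (offer v₀ v₂
        (goto 4F false (P ∷ v₂ ∷ v₀ ∷ v₁ ∷ [])) void
        (goto 2F false (P ∷ v₂ ∷ v₁ ∷ v₀ ∷ []))) void)
    (offer v₀ v₂
      (offer v₁ v₂
        (goto 1F false (v₁ ∷ v₂ ∷ v₀ ∷ P⁻ ∷ [])) void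
        (goto 2F false (v₁ ∷ P ∷ v₀ ∷ v₂ ∷ []))) void
      (goto 2F false (v₀ ∷ P ∷ v₁ ∷ v₂ ∷ [])))
    (offer v₀ v₂
      (offer a v₁
        (offer b v₂
          (goto 3F false (v₁ ∷ P ∷ v₂ ∷ v₀ ∷ []))
          (goto 2F false (P⁻ ∷ v₁ ∷ v₂ ∷ v₀ ∷ [])) void)
        (goto 2F false (P ∷ v₁ ∷ v₂ ∷ v₀ ∷ [])) void)
      (goto 2F false (v₀ ∷ P ∷ v₂ ∷ v₁ ∷ [])) void)

closeRB : Tree 1 (finish ∷ reach S½ ∷ [])
closeRB =
  offer a v₀
    (offer b v₀
      (goto 0F false (P ∷ v₀ ∷ []))
      (goto 1F true (P⁻ ∷ [])) void) void
    (goto 1F false (P ∷ []))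

growRB : Tree 1 (reach ½0 ∷ reach S½ ∷ [])
growRB =
  offer a v₀
    (goto 0F false (P⁻ ∷ v₀ ∷ [])) void
    (goto 1F false (P ∷ []))

close½0 : Tree 1 (finish ∷ reach S0 ∷ reach RB ∷ reach BB ∷ [])
close½0 =
  offer b v₀
    (offer a v₀
      (goto 0F false (P ∷ v₀ ∷ []))
      (goto 1F false (P ∷ [])) void)
    (goto 2F false (P⁻ ∷ []))
    (goto 3F false (P ∷ []))

grow½0 : Tree 1 (reach ½0 ∷ reach RB ∷ reach BB ∷ [])
grow½0 =
  offer b v₀
    (goto 0F false (P ∷ v₀ ∷ []))
    (goto 1F false (P⁻ ∷ []))
    (goto 2F false (P ∷ []))

-- Every leaf gains three vertices, and non-green answers are repaid in colours at the ends: none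
-- leaves `½0`, one leads to `RB` or `BB`, two lead to `S½`.
three½0 : Tree 1 (reach ½0 ∷ reach RB ∷ reach S½ ∷ reach BB ∷ [])
three½0 =
  offer v₀ v₁
    (offer b v₂
      (offer v₀ v₂
        (goto 0F false (P ∷ v₂ ∷ v₀ ∷ v₁ ∷ []))
        (offer v₁ v₂
          (goto 1F false (v₀ ∷ v₁ ∷ v₂ ∷ P⁻ ∷ [])) void
          (goto 2F false (v₂ ∷ P⁻ ∷ v₀ ∷ v₁ ∷ [])))
        (offer a v₁
          (goto 3F false (v₀ ∷ v₁ ∷ P ∷ v₂ ∷ []))
          (goto 2F false (P ∷ v₂ ∷ v₁ ∷ v₀ ∷ [])) void))
      (offer v₀ v₂
        (offer b v₁
          (goto 1F false (v₂ ∷ v₀ ∷ v₁ ∷ P⁻ ∷ [])) void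
          (goto 2F false (P⁻ ∷ v₂ ∷ v₀ ∷ v₁ ∷ []))) void
        (goto 2F false (v₂ ∷ v₁ ∷ v₀ ∷ P⁻ ∷ [])))
      (offer v₀ v₂
        (offer a v₁
          (goto 3F false (v₂ ∷ v₀ ∷ v₁ ∷ P ∷ []))
          (goto 2F false (P ∷ v₁ ∷ v₀ ∷ v₂ ∷ [])) void)
        (goto 2F false (v₂ ∷ v₁ ∷ v₀ ∷ P⁻ ∷ [])) void))
    (offer v₀ v₂
      (offer b v₁
        (offer v₁ v₂
          (goto 1F false (v₀ ∷ v₂ ∷ v₁ ∷ P⁻ ∷ [])) void
          (goto 2F false (v₁ ∷ P⁻ ∷ v₀ ∷ v₂ ∷ []))) void
        (goto 2F false (v₁ ∷ v₂ ∷ v₀ ∷ P⁻ ∷ []))) void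
      (goto 2F false (v₀ ∷ P⁻ ∷ v₁ ∷ v₂ ∷ [])))
    (offer v₀ v₂
      (offer b v₁
        (offer a v₂
          (goto 3F false (v₀ ∷ v₂ ∷ P ∷ v₁ ∷ []))
          (goto 2F false (P ∷ v₁ ∷ v₂ ∷ v₀ ∷ [])) void)
        (goto 2F false (v₁ ∷ v₂ ∷ v₀ ∷ P⁻ ∷ [])) void)
      (goto 2F false (v₀ ∷ P⁻ ∷ v₂ ∷ v₁ ∷ [])) void)

-- The parameter `last` continues after four green answers, the one line in which no colour has
-- appeared. It either keeps the longer path with bare ends or tries to close the cycle.
fourOO : ∀ {t} (last : Tree 1 (reach ½0 ∷ reach BB ∷ reach S½ ∷ reach S½ ∷ reach ½0 ∷ t ∷ [])) →
         Tree 1 (reach ½0 ∷ reach BB ∷ reach S½ ∷ reach S½ ∷ reach ½0 ∷ t ∷ [])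
fourOO last =
  offer b v₀
    (offer v₀ v₁
      (offer v₁ v₂
        (offer v₂ v₃
          last
          (goto 0F true (v₂ ∷ v₁ ∷ v₀ ∷ P⁻ ∷ []))
          (goto 0F false (v₂ ∷ v₁ ∷ v₀ ∷ P⁻ ∷ [])))
        (offer a v₂
          (goto 1F true (v₂ ∷ P ∷ v₀ ∷ v₁ ∷ [])) void
          (goto 2F true (v₂ ∷ v₀ ∷ P⁻ ∷ v₁ ∷ [])))
        (offer a v₂
          (goto 1F false (v₂ ∷ P ∷ v₀ ∷ v₁ ∷ []))
          (goto 2F false (v₂ ∷ v₀ ∷ P⁻ ∷ v₁ ∷ [])) void))
      (offer a v₁
        (offer v₀ v₂
          (goto 0F true (v₁ ∷ P ∷ v₀ ∷ v₂ ∷ [])) void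
          (goto 3F true (v₀ ∷ P⁻ ∷ v₁ ∷ []))) void
        (offer a v₂
          (goto 2F true (v₁ ∷ v₂ ∷ P ∷ v₀ ∷ []))
          (goto 2F true (v₁ ∷ v₃ ∷ P ∷ v₀ ∷ [])) void))
      (offer a v₁
        (offer v₀ v₂
          (goto 0F false (v₁ ∷ P ∷ v₀ ∷ v₂ ∷ []))
          (goto 3F false (v₀ ∷ P⁻ ∷ v₁ ∷ [])) void)
        (offer a v₂
          (goto 2F false (v₁ ∷ v₂ ∷ P ∷ v₀ ∷ [])) void
          (goto 2F false (v₁ ∷ v₃ ∷ P ∷ v₀ ∷ []))) void))
    (goto 4F true (P⁻ ∷ []))
    (goto 4F false (P⁻ ∷ []))

-- Trees for two paths and for the empty board

-- The parameter `end` treats the tight line, where four vertices cost six rounds and the two paths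
-- keep their kinds. They either stay apart for another turn or are joined into the cycle by two
-- more edges, forced because both ends of the first path meet red and blue.
fourSS∣RB : ∀ {t} → (Bool → Path⁺ 2 → Path⁺ 2 → Tree 2 (reach S0 ∷ reach S½ ∷ t ∷ [])) →
            Tree 2 (reach S0 ∷ reach S½ ∷ t ∷ [])
fourSS∣RB end =
  offer v₀ v₁
    (offer a′ v₂
      (offer b′ v₀
        (goto 0F false (P ∷ v₁ ∷ v₀ ∷ Q⁻ ∷ v₂ ∷ []))
        (goto 1F true (P ∷ v₂ ∷ Q ∷ v₁ ∷ v₀ ∷ [])) void) void
      (offer v₀ v₂
        (goto 1F false (P ∷ v₂ ∷ v₀ ∷ v₁ ∷ Q ∷ []))
        (end true (P ∷ v₃ ∷ v₂ ∷ []) (Q⁻ ∷ v₁ ∷ v₀ ∷ [])) void))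
    (offer v₀ v₂
      (offer a′ v₁
        (goto 1F true (P ∷ v₂ ∷ v₀ ∷ Q⁻ ∷ v₁ ∷ [])) void
        (end true (P ∷ v₃ ∷ v₁ ∷ []) (Q⁻ ∷ v₂ ∷ v₀ ∷ []))) void
      (end false (P ∷ v₃ ∷ v₀ ∷ []) (Q ∷ v₁ ∷ v₂ ∷ [])))
    (offer v₀ v₂
      (offer b′ v₁
        (goto 1F false (P ∷ v₂ ∷ v₀ ∷ Q ∷ v₁ ∷ []))
        (end false (P ∷ v₃ ∷ v₁ ∷ []) (Q ∷ v₂ ∷ v₀ ∷ [])) void)
      (end false (P ∷ v₃ ∷ v₀ ∷ []) (Q ∷ v₂ ∷ v₁ ∷ [])) void)

-- Three vertices carry the whole start. If one edge is green, one red and one blue, the vertex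
-- meeting red and blue becomes the first path of `SS∣RB` and the green edge the second.
opening : Tree 0 (reach OO ∷ reach BB ∷ reach SS∣RB ∷ [])
opening =
  offer v₀ v₁
    (offer v₁ v₂
      (goto 0F false (v₀ ∷ v₁ ∷ v₂ ∷ []))
      (offer v₀ v₂
        (goto 1F true (v₁ ∷ v₀ ∷ v₂ ∷ [])) void
        (leaf 2F false ((v₂ ∷ []) ∷ (v₁ ∷ v₀ ∷ []) ∷ [])))
      (offer v₀ v₂
        (goto 1F false (v₁ ∷ v₀ ∷ v₂ ∷ []))
        (leaf 2F false ((v₂ ∷ []) ∷ (v₀ ∷ v₁ ∷ []) ∷ [])) void))
    (offer v₁ v₂
      (offer v₀ v₂
        (goto 1F true (v₁ ∷ v₂ ∷ v₀ ∷ [])) void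
        (leaf 2F false ((v₀ ∷ []) ∷ (v₁ ∷ v₂ ∷ []) ∷ []))) void
      (leaf 2F false ((v₁ ∷ []) ∷ (v₀ ∷ v₂ ∷ []) ∷ [])))
    (offer v₁ v₂
      (offer v₀ v₂
        (goto 1F false (v₁ ∷ v₂ ∷ v₀ ∷ []))
        (leaf 2F false ((v₀ ∷ []) ∷ (v₂ ∷ v₁ ∷ []) ∷ [])) void)
      (leaf 2F false ((v₁ ∷ []) ∷ (v₂ ∷ v₀ ∷ []) ∷ [])) void)

-- Induction on the number of missing vertices

win-mono : ∀ {l k} {κ : Kind k} {r n n′} → n ≤ n′ → Win l κ r n → Win l κ r n′
win-mono n≤n′ win st eq = wins-mono n≤n′ (win st eq)

-- Completing a single path that lacks r vertices takes r + 1 green edges, so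
-- n − r − 1 non-green (or unused) edges are affordable.
module Strategy (l : ℕ) where

  -- The subscript gives the number of missing vertices modulo four. `S0` has one round more than
  -- `S½`, the price of a colour at its bare end.
  S½₁ : ∀ j → Win l S½ (1 + j * 4) (3 + j * 6)
  S½₂ : ∀ j → Win l S½ (2 + j * 4) (5 + j * 6)
  S½₃ : ∀ j → Win l S½ (3 + j * 4) (7 + j * 6)
  S½₄ : ∀ j → Win l S½ (4 + j * 4) (8 + j * 6)
  S0₁ : ∀ j → Win l S0 (1 + j * 4) (4 + j * 6)
  S0₂ : ∀ j → Win l S0 (2 + j * 4) (6 + j * 6)
  S0₃ : ∀ j → Win l S0 (3 + j * 4) (8 + j * 6)
  S0₄ : ∀ j → Win l S0 (4 + j * 4) (9 + j * 6)

  S½₁ zero = play ((0 , 0) ∷ []) 1 3 closeS½ 0 0 (refl , tt)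
  -- `suc j * 4` unfolds to `4 + j * 4`, whence the numerals 5 and 9. The last budget is the tight
  -- line, back to `S½₁ j` with four vertices and six rounds fewer.
  S½₁ (suc j) = play ((2 , 6) ∷ (2 , 5) ∷ (1 , 3) ∷ []) 5 9 fourS½ (j * 4) (j * 6) (S0₂ j , S½₂ j , S½₁ j , tt)
  S½₂ j = play ((1 , 4) ∷ (1 , 3) ∷ []) 2 5 growS½ (j * 4) (j * 6) (S0₁ j , S½₁ j , tt)
  S½₃ j = play ((2 , 6) ∷ (2 , 5) ∷ []) 3 7 growS½ (j * 4) (j * 6) (S0₂ j , S½₂ j , tt)
  S½₄ j = play ((2 , 6) ∷ (2 , 5) ∷ (1 , 3) ∷ []) 4 8 threeS½ (j * 4) (j * 6) (S0₂ j , S½₂ j , S½₁ j , tt)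
  S0₁ zero = play ((0 , 0) ∷ (1 , 3) ∷ []) 1 4 closeS0 0 0 (refl , S½₁ 0 , tt)
  S0₁ (suc j) = play ((4 , 9) ∷ (5 , 9) ∷ []) 5 10 growS0 (j * 4) (j * 6) (S0₄ j , S½₁ (suc j) , tt)
  S0₂ j = play ((1 , 4) ∷ (2 , 5) ∷ []) 2 6 growS0 (j * 4) (j * 6) (S0₁ j , S½₂ j , tt)
  S0₃ j = play ((2 , 6) ∷ (3 , 7) ∷ []) 3 8 growS0 (j * 4) (j * 6) (S0₂ j , S½₃ j , tt)
  S0₄ j = play ((3 , 8) ∷ (4 , 8) ∷ []) 4 9 growS0 (j * 4) (j * 6) (S0₃ j , S½₄ j , tt)

  BB₁ : Win l BB 1 5
  BB₁ = play ((0 , 0) ∷ (1 , 3) ∷ []) 1 5 closeBB 0 0 (refl , S½₁ 0 , tt)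

  RB₁ : Win l RB 1 5
  RB₁ = play ((0 , 0) ∷ (1 , 3) ∷ []) 1 5 closeRB 0 0 (refl , S½₁ 0 , tt)

  ½0₁ : Win l ½0 1 6
  ½0₁ = play ((0 , 0) ∷ (1 , 4) ∷ (1 , 5) ∷ (1 , 5) ∷ []) 1 6 close½0 0 0 (refl , S0₁ 0 , RB₁ , BB₁ , tt)

  ½0₄ : ∀ j → Win l ½0 (4 + j * 4) (9 + j * 6)
  BB₅ : ∀ j → Win l BB (5 + j * 4) (10 + j * 6)
  RB₅ : ∀ j → Win l RB (5 + j * 4) (10 + j * 6)
  ½0₅ : ∀ j → Win l ½0 (5 + j * 4) (11 + j * 6)
  ½0₈ : ∀ j → Win l ½0 (8 + j * 4) (14 + j * 6)

  ½0₄ zero = play ((1 , 6) ∷ (1 , 5) ∷ (1 , 3) ∷ (1 , 5) ∷ []) 4 9 three½0 0 0 (½0₁ , RB₁ , S½₁ 0 , BB₁ , tt)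
  -- Eight missing vertices admit a better bound than the pattern of `½0₄` asks for, with one round
  -- to spare.
  ½0₄ (suc j) = win-mono (n≤1+n _) (½0₈ j)
  BB₅ j = play ((4 , 9) ∷ (5 , 9) ∷ []) 5 10 growBB (j * 4) (j * 6) (½0₄ j , S½₁ (suc j) , tt)
  RB₅ j = play ((4 , 9) ∷ (5 , 9) ∷ []) 5 10 growRB (j * 4) (j * 6) (½0₄ j , S½₁ (suc j) , tt)
  ½0₅ j = play ((4 , 9) ∷ (5 , 10) ∷ (5 , 10) ∷ []) 5 11 grow½0 (j * 4) (j * 6) (½0₄ j , RB₅ j , BB₅ j , tt)
  ½0₈ j = play ((5 , 11) ∷ (5 , 10) ∷ (5 , 9) ∷ (5 , 10) ∷ []) 8 14 three½0 (j * 4) (j * 6)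
    (½0₅ j , RB₅ j , S½₁ (suc j) , BB₅ j , tt)

  BB₈ : ∀ j → Win l BB (8 + j * 4) (14 + j * 6)
  BB₈ j = play ((5 , 11) ∷ (5 , 10) ∷ (5 , 9) ∷ (5 , 10) ∷ (5 , 10) ∷ []) 8 14 threeBB (j * 4) (j * 6)
    (½0₅ j , RB₅ j , S½₁ (suc j) , BB₅ j , S0₁ (suc j) , tt)

  OO₄ : ∀ j → Win l OO (4 + j * 4) (11 + j * 6)
  OO₈ : ∀ j → Win l OO (8 + j * 4) (15 + j * 6)

  OO₄ zero = play ((1 , 6) ∷ (1 , 5) ∷ (1 , 3) ∷ (2 , 5) ∷ (4 , 9) ∷ (0 , 0) ∷ []) 4 11
    (fourOO {finish} (offer a v₃
      (goto 5F false (P ∷ v₀ ∷ v₁ ∷ v₂ ∷ v₃ ∷ []))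
      (goto 0F true (P ∷ v₀ ∷ v₁ ∷ v₂ ∷ []))
      (goto 0F false (P ∷ v₀ ∷ v₁ ∷ v₂ ∷ []))))
    0 0 (½0₁ , BB₁ , S½₁ 0 , S½₂ 0 , ½0₄ 0 , refl , tt)
  -- Here two rounds are to spare.
  OO₄ (suc j) = win-mono (m≤n+m _ 2) (OO₈ j)
  OO₈ j = play ((5 , 11) ∷ (5 , 10) ∷ (5 , 9) ∷ (6 , 11) ∷ (8 , 14) ∷ (4 , 11) ∷ []) 8 15
    (fourOO {reach OO} (goto 5F false (P ∷ v₀ ∷ v₁ ∷ v₂ ∷ v₃ ∷ [])))
    (j * 4) (j * 6) (½0₅ j , BB₅ j , S½₁ (suc j) , S½₂ (suc j) , ½0₈ j , OO₄ j , tt)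

  SS∣RB₄ : ∀ j → Win l SS∣RB (4 + j * 4) (8 + j * 6)
  SS∣RB₄ zero = play ((1 , 4) ∷ (1 , 3) ∷ (0 , 0) ∷ []) 4 8
    (fourSS∣RB {finish} (λ _ p q → goto 2F false (p ⁺++⁺ q))) 0 0 (S0₁ 0 , S½₁ 0 , refl , tt)
  SS∣RB₄ (suc j) = play ((5 , 10) ∷ (5 , 9) ∷ (4 , 8) ∷ []) 8 14
    (fourSS∣RB {reach SS∣RB} (λ s p q → leaf 2F s (p ∷ q ∷ []))) (j * 4) (j * 6) (S0₁ (suc j) , S½₁ (suc j) , SS∣RB₄ j , tt)

  -- The numerals are `4 * k + 3` and `6 * k + 5` at `k = 2`; each unit of `j` adds a block of four
  -- vertices and six rounds. After the opening eight vertices are missing in every branch, with 15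
  -- rounds left if both answers were green and 14 otherwise.
  fromEmpty : ∀ j → Win l [] (11 + j * 4) (17 + j * 6)
  fromEmpty j = play ((8 , 15) ∷ (8 , 14) ∷ (8 , 14) ∷ []) 11 17 opening (j * 4) (j * 6)
    (OO₈ j , BB₈ j , SS∣RB₄ (suc j) , tt)

-- The empty board and the bound

emptyState : State [] [] 0
emptyState = record
  { N = 0 ; below = [] ; swapped = false
  ; first = λ () ; last = λ () ; vs = λ () ; walk = λ () ; unique = λ () ; disjoint = λ { {()} }
  ; inside = λ () ; leftColours = λ () ; rightColours = λ () ; ends≢ = λ () ; size = refl }

theorem4p19 : ∀ (k : ℕ) → 4 ≤ k →
    OnlineRamseyAtMost (Path 3) (Path 3) (Cycle (4 * k + 3)) (6 * k + 5)
theorem4p19 (suc (suc j)) (s≤s (s≤s _)) =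
  subst (λ n → BuilderWinsWithin (Path 3) (Path 3) (Cycle (4 * suc (suc j) + 3)) n []) (rounds j)
    (Strategy.fromEmpty (4 * suc (suc j) + 3) j emptyState (vertices j))
  where
  rounds : ∀ j → 17 + j * 6 ≡ 6 * suc (suc j) + 5
  rounds = solve-∀
  vertices : ∀ j → 11 + j * 4 ≡ 4 * suc (suc j) + 3
  vertices = solve-∀
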